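{- For all integers $d,k\geq 1$ and $m\geq 2$ there exists an integer $k_0=k_0(d,k,m)\geq 1$ with the following property. Let $G$ be a graph and let $B_0$ be a strong $k_0$-block in $G$. Assume that $G$ does not contain a $(\leq d)$-subdivision of $K_m$ as a subgraph. Then there exist $A\subseteq V(G)$ and $S\subseteq B_0\setminus A$ such that $S$ is both a strong $k$-block and a $d$-stable set in $G\setminus A$.
   Context: All graphs are finite and simple; a path in $G$ means an induced subgraph of $G$ that is a path, and its length is its number of edges. A strong $k$-block in $G$ is a set $B$ of at least $k$ vertices of $G$ such that for every $2$-subset $\{x,y\}$ of $B$ there is a collection $\mathcal{P}_{\{x,y\}}$ of at least $k$ distinct, pairwise internally disjoint paths in $G$ from $x$ to $y$, where for any two distinct $2$-subsets $\{x,y\},\{x',y'\}\subseteq B$ and any $P\in\mathcal{P}_{\{x,y\}}$, $P'\in\mathcal{P}_{\{x',y'\}}$ we have $V(P)\cap V(P')=\{x,y\}\cap\{x',y'\}$. A $d$-stable set in $G$ is a set $S\subseteq V(G)$ such that for every two distinct $u,v\in S$ there is no path of length at most $d$ in $G$ from $u$ to $v$. A $(\leq d)$-subdivision of a graph is a subdivision in which each edge is replaced by a path of length at most $d+1$. -}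

module Defs where

open import Data.Nat using (ℕ; zero; suc; _≤_; _∸_)
open import Data.Fin using (Fin; toℕ) renaming (_<_ to _<ᶠ_)
open import Data.Fin.Subset using (Subset; _∈_; _⊆_; ∣_∣)
open import Data.Bool using (Bool; true; false)
open import Data.List using (List; []; _∷_; length; lookup; head; last)
open import Data.List.Membership.Propositional using () renaming (_∈_ to _∈ₗ_)
open import Data.List.Relation.Unary.All using (All)
open import Data.List.Relation.Unary.Unique.Propositional using (Unique)
open import Data.Maybe using (just)
open import Data.Product using (Σ; _×_; ∃; ∃-syntax)
open import Data.Sum using (_⊎_)
open import Data.Unit using (⊤)
open import Relation.Nullary using (¬_)
open import Relation.Binary.PropositionalEquality using (_≡_; _≢_)
open import Function.Bundles using (_⇔_)

record Graph : Set where
  field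
    n     : ℕ
    adj   : Fin n → Fin n → Bool
    sym   : ∀ u v → adj u v ≡ adj v u
    irref : ∀ v → adj v v ≡ false

module _ (G : Graph) where
  open Graph G

  Adj : Fin n → Fin n → Set
  Adj u v = adj u v ≡ true

  -- Induced subgraphs are represented by their vertex set U (G[U]);
  -- G itself is G[⊤] and G \ A is G[∁ A].

  -- p (listing v₀,…,v_ℓ) is a path of G[U] (an induced path, as in the paper).
  IsPath : Subset n → List (Fin n) → Set
  IsPath U p =
    All (_∈ U) p × Unique p ×
    (∀ (i j : Fin (length p)) →
       Adj (lookup p i) (lookup p j) ⇔ (suc (toℕ i) ≡ toℕ j ⊎ suc (toℕ j) ≡ toℕ i))

  FromTo : Fin n → Fin n → List (Fin n) → Set
  FromTo x y p = head p ≡ just x × last p ≡ just y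

  pathLength : List (Fin n) → ℕ
  pathLength p = length p ∸ 1

  -- Strong k-block in G[U].  The unordered pair {x,y} is indexed by x < y.
  -- cnt x y = size of the collection P_{x,y}, paths x y i its members.
  StrongBlock : Subset n → ℕ → Subset n → Set
  StrongBlock U k B =
    B ⊆ U × k ≤ ∣ B ∣ ×
    Σ (Fin n → Fin n → ℕ) λ cnt →
    Σ ((x y : Fin n) → Fin (cnt x y) → List (Fin n)) λ paths →
      (∀ x y → x ∈ B → y ∈ B → x <ᶠ y →
         k ≤ cnt x y
         × (∀ i → IsPath U (paths x y i) × FromTo x y (paths x y i))
         × (∀ i j → i ≢ j → paths x y i ≢ paths x y j)
         × (∀ i j → i ≢ j → ∀ v → v ∈ₗ paths x y i → v ∈ₗ paths x y j →
              v ≡ x ⊎ v ≡ y))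
      × (∀ x y x' y' → x ∈ B → y ∈ B → x' ∈ B → y' ∈ B → x <ᶠ y → x' <ᶠ y' →
           ¬ (x ≡ x' × y ≡ y') →
           ∀ i i' v → v ∈ₗ paths x y i → v ∈ₗ paths x' y' i' →
             (v ≡ x ⊎ v ≡ y) × (v ≡ x' ⊎ v ≡ y'))

  Stable : Subset n → ℕ → Subset n → Set
  Stable U d S =
    ∀ u v → u ∈ S → v ∈ S → u ≢ v →
      ¬ (∃[ p ] (IsPath U p × FromTo u v p × pathLength p ≤ d))

  Chain : List (Fin n) → Set
  Chain []            = ⊤
  Chain (x ∷ [])      = ⊤
  Chain (x ∷ y ∷ r)   = Adj x y × Chain (y ∷ r)

  -- a path of G regarded as a subgraph (not necessarily induced)
  IsSubPath : List (Fin n) → Set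
  IsSubPath p = Unique p × Chain p

  HasSubdivision : ℕ → ℕ → Set
  HasSubdivision d m =
    Σ (Fin m → Fin n) λ b →
    Σ (Fin m → Fin m → List (Fin n)) λ Q →
      (∀ i j → b i ≡ b j → i ≡ j)
      × (∀ i j → i <ᶠ j →
           IsSubPath (Q i j) × FromTo (b i) (b j) (Q i j)
           × pathLength (Q i j) ≤ suc d
           × (∀ l → b l ∈ₗ Q i j → l ≡ i ⊎ l ≡ j))
      × (∀ i j i' j' → i <ᶠ j → i' <ᶠ j' → ¬ (i ≡ i' × j ≡ j') →
           ∀ v → v ∈ₗ Q i j → v ∈ₗ Q i' j' → ∃[ l ] (v ≡ b l))

{-# OPTIONS --safe #-}
module Submission where

open import Defs
open import Data.Nat using (ℕ; zero; suc; _+_; _*_; _≤_; z≤n; s≤s; _≤?_)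
open import Data.Nat.Properties using (≤-refl; ≤-reflexive; ≤-trans; ≤⇒≯; ≰⇒>; n≤1+n; +-mono-≤; +-mono-<; +-monoˡ-≤; *-monoˡ-≤; *-identityʳ; m≤m+n; m≤n+m; m≤n⇒m≤1+n; m≤n⇒m⊓n≡m; m+n∸m≡n; m≤n+m∸n; ∸-monoˡ-≤; +-suc; +-comm; suc-injective)
open import Data.Bool using (true)
import Data.Bool.Properties as Bool
open import Data.Fin using (Fin; zero; suc; toℕ) renaming (_<_ to _<ᶠ_)
open import Data.Fin.Properties using (_≟_; _<?_; any?; <-cmp; <-irrefl; <-asym)
open import Data.Fin.Subset using (Subset; inside; outside; ∣_∣; _⊆_; _∩_; ∁; ⊤) renaming (_∈_ to _∈ₛ_)
open import Data.Fin.Subset.Properties using (x∉p⇒x∈∁p; x∈∁p⇒x∉p; x∈p∩q⁺) renaming (_∈?_ to _∈ₛ?_)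
open import Data.List using (List; []; _∷_; _++_; length; lookup; head; last; map; filter; concatMap; take; drop; allFin; reverse; _ʳ++_)
open import Data.List.Properties using (length-++; length-map; length-tabulate; length-filter; length-reverse; length-take; length-drop; take++drop≡id; filter-all)
open import Data.List.Membership.Propositional using (_∈_; _∉_; lose)
open import Data.List.Membership.Propositional.Properties using (∈-++⁺ˡ; ∈-++⁺ʳ; ∈-lookup; ∈-map⁺; ∈-map⁻; ∈-filter⁺; ∈-filter⁻; ∈-concatMap⁺; ∈-allFin; ∈-AllPairs₂)
import Data.List.Membership.DecPropositional as DecMembership
open import Data.List.Relation.Binary.Permutation.Setoid using (↭-sym)
import Data.List.Relation.Binary.Permutation.Setoid.Properties as Permutation
open import Data.List.Relation.Binary.Sublist.Propositional using ([]; _∷_; _∷ʳ_; ⊆-refl; ⊆-trans; ⊆-reflexive; minimum; from∈) renaming (_⊆_ to _⊑_)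
open import Data.List.Relation.Binary.Sublist.Propositional.Properties using (All-resp-⊆; Any-resp-⊆; filter-⊆; length-mono-≤; ++⁺; take-⊆; drop-⊆) renaming (filter⁺ to ⊆-filter⁺)
open import Data.List.Relation.Unary.All as All using (All; []; _∷_)
import Data.List.Relation.Unary.All.Properties as All
open import Data.List.Relation.Unary.AllPairs as AllPairs using (AllPairs; []; _∷_)
import Data.List.Relation.Unary.AllPairs.Properties as AllPairs
open import Data.List.Relation.Unary.Any using (here; there)
open import Data.List.Relation.Unary.Any.Properties using (reverse⁻)
open import Data.List.Relation.Unary.Unique.Propositional using (Unique)
import Data.List.Relation.Unary.Unique.Propositional.Properties as Unique
import Data.List.Relation.Unary.Unique.DecPropositional as DecUnique
open import Data.Maybe using (just)
import Data.Maybe.Properties as Maybe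
open import Data.Product using (Σ; _×_; _,_; ∃; ∃-syntax; proj₁; proj₂)
import Data.Product.Properties as Product
open import Data.Sum as Sum using (_⊎_; inj₁; inj₂; [_,_]′)
open import Data.Unit using (tt)
open import Data.Vec as Vec using ([]; _∷_; here; there)
open import Data.Vec.Properties using (lookup∘tabulate; lookup⇒[]=; []=⇒lookup)
open import Function using (_∘_; id)
open import Function.Bundles using (Equivalence)
open import Relation.Binary using (DecidableEquality; Decidable; tri<; tri≈; tri>)
open import Relation.Binary.PropositionalEquality using (_≡_; _≢_; refl; sym; trans; cong; subst; setoid)
open import Relation.Nullary using (¬_; Dec; yes; no; contradiction; ¬?; does)
open import Relation.Nullary.Decidable using (decidable-stable; _×-dec_; _⊎-dec_; map′; dec-true)
open import Relation.Unary using () renaming (Decidable to Decidable₁)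

-- Call x, y separable if at most c vertices other than x and y meet all x–y paths of
-- length at most d, where c depends only on d and m.  By Ramsey's theorem B₀ contains m
-- pairwise inseparable vertices, between which disjoint short paths can be chosen greedily
-- to form a (≤ d)-subdivision of K_m, or a large set of pairwise separable vertices.
-- In the latter case each vertex v of the separator of {x, y} lies inside at most one path
-- of the block, belonging to one pair {z, w}.  A free-set argument shrinks the set to S so
-- that v ∉ S, and {z, w} ⊆ S only if {z, w} = {x, y}.  Deleting the separators of all
-- pairs of S then destroys at most c paths of each pair, and leaves S d-stable.

-- Sublists, counting and splitting of lists.

private
  variable
    n : ℕ
    A B : Set

AllPairs-resp-⊆ : {R : A → A → Set} {xs ys : List A} → ys ⊑ xs → AllPairs R xs → AllPairs R ys
AllPairs-resp-⊆ []         []       = []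
AllPairs-resp-⊆ (_ ∷ʳ τ)   (_ ∷ ps) = AllPairs-resp-⊆ τ ps
AllPairs-resp-⊆ (refl ∷ τ) (p ∷ ps) = All-resp-⊆ τ p ∷ AllPairs-resp-⊆ τ ps

AllPairs-lookup : {R : A → A → Set} {xs : List A} → AllPairs R xs →
                  ∀ i j → i <ᶠ j → R (lookup xs i) (lookup xs j)
AllPairs-lookup (p ∷ _)  zero    (suc j) _         = All.lookup p (∈-lookup j)
AllPairs-lookup (_ ∷ ps) (suc i) (suc j) (s≤s i<j) = AllPairs-lookup ps i j i<j

length-concatMap-≤ : (f : A → List B) {b : ℕ} → (∀ x → length (f x) ≤ b) →
                     ∀ xs → length (concatMap f xs) ≤ length xs * b
length-concatMap-≤ f h []       = z≤n
length-concatMap-≤ f h (x ∷ xs) =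
  ≤-trans (≤-reflexive (length-++ (f x))) (+-mono-≤ (h x) (length-concatMap-≤ f h xs))

length-filter-split : {P : A → Set} (P? : Decidable₁ P) (xs : List A) →
                      length xs ≤ length (filter P? xs) + length (filter (¬? ∘ P?) xs)
length-filter-split P? []       = z≤n
length-filter-split P? (x ∷ xs) with P? x
... | yes _ = s≤s (length-filter-split P? xs)
... | no  _ = ≤-trans (s≤s (length-filter-split P? xs)) (≤-reflexive (sym (+-suc _ _)))

+-≤-split : ∀ {a b i o} → a + b ≤ i + o → a ≤ i ⊎ b ≤ o
+-≤-split {a} {b} {i} {o} h with a ≤? i | b ≤? o
... | yes p | _     = inj₁ p
... | no _  | yes q = inj₂ q
... | no p  | no q  = contradiction (+-mono-< (≰⇒> p) (≰⇒> q)) (≤⇒≯ h)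

-- Ramsey's theorem for sublists.

Homogeneous : (A → A → Set) → ℕ → List A → Set
Homogeneous R k xs = ∃[ ys ] (ys ⊑ xs × length ys ≡ k × AllPairs R ys)

Homogeneous-⊆ : {R : A → A → Set} {k : ℕ} {xs ys : List A} → xs ⊑ ys →
                Homogeneous R k xs → Homogeneous R k ys
Homogeneous-⊆ τ (zs , σ , rest) = zs , ⊆-trans σ τ , rest

Homogeneous-∷ : {R : A → A → Set} {k : ℕ} {xs : List A} (x : A) (Rx? : Decidable₁ (R x)) →
                Homogeneous R k (filter Rx? xs) → Homogeneous R (suc k) (x ∷ xs)
Homogeneous-∷ {xs = xs} x Rx? (ys , τ , len , ps) =
  x ∷ ys , refl ∷ ⊆-trans τ (filter-⊆ Rx? xs) , cong suc len ,
  All-resp-⊆ τ (All.all-filter Rx? xs) ∷ ps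

-- An upper bound of Erdős-Szekeres type, not the exact Ramsey number: one entry for the chosen head
-- plus what either class of the remaining entries may require.
ramseyNumber : ℕ → ℕ → ℕ
ramseyNumber zero    l       = 0
ramseyNumber (suc k) zero    = 0
ramseyNumber (suc k) (suc l) = suc (ramseyNumber k (suc l) + ramseyNumber (suc k) l)

-- The head splits the tail into the entries related to it and the others, and one class is large
-- enough for induction. Only pairs in list order are compared, so `R` may be asymmetric.
ramsey : {R : A → A → Set} → Decidable R → ∀ k l xs → ramseyNumber k l ≤ length xs →
         Homogeneous R k xs ⊎ Homogeneous (λ x y → ¬ R x y) l xs
ramsey R? zero    l       xs       _       = inj₁ ([] , minimum xs , refl , [])
ramsey R? (suc k) zero    xs       _       = inj₂ ([] , minimum xs , refl , [])
ramsey R? (suc k) (suc l) (x ∷ xs) (s≤s h)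
  with +-≤-split {ramseyNumber k (suc l)} (≤-trans h (length-filter-split (R? x) xs))
... | inj₁ h₁ = Sum.map (Homogeneous-∷ x (R? x))
                        (Homogeneous-⊆ (x ∷ʳ filter-⊆ (R? x) xs))
                        (ramsey R? k (suc l) (filter (R? x) xs) h₁)
... | inj₂ h₂ = Sum.map (Homogeneous-⊆ (x ∷ʳ filter-⊆ (¬? ∘ R? x) xs))
                        (Homogeneous-∷ x (¬? ∘ R? x))
                        (ramsey R? (suc k) l (filter (¬? ∘ R? x) xs) h₂)

-- Free sets for bounded set mappings.

candidateNumber : ℕ → ℕ → ℕ
candidateNumber zero    N = 2
candidateNumber (suc t) N = ramseyNumber N (candidateNumber t N)

-- The `suc (c + e)` candidates outnumber any list `f y z ++ g z`. From the pool must come one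
-- auxiliary entry, at most `e` entries lost to `g a`, and enough for the recursion, where `g` has
-- grown by at most `c`.
freeNumber : ℕ → ℕ → ℕ → ℕ
freeNumber zero    c e = 0
freeNumber (suc k) c e =
  suc (c + e) + candidateNumber (suc (c + e)) (suc (e + freeNumber k c (e + c)))

module _ (_≟_ : DecidableEquality A) where

  open DecMembership _≟_ using (_∈?_)

  removeOne : ∀ a {N} xs → Unique xs → suc N ≤ length xs →
              ∃[ ys ] (ys ⊑ xs × N ≤ length ys × All (_≢ a) ys)
  removeOne a {zero} xs u h = [] , minimum xs , z≤n , []
  removeOne a {suc N} (x ∷ xs) (x≢ ∷ u) (s≤s h) with x ≟ a
  ... | yes refl = xs , x ∷ʳ ⊆-refl , h , All.map (_∘ sym) x≢
  ... | no x≢a   = let ys , τ , len , ps = removeOne a xs u h in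
                   x ∷ ys , refl ∷ τ , s≤s len , x≢a ∷ ps

  -- Without repetitions in `xs`, each entry of `L` costs at most one entry of `xs`.
  removeAll : ∀ L {N} xs → Unique xs → length L + N ≤ length xs →
              ∃[ ys ] (ys ⊑ xs × N ≤ length ys × All (_∉ L) ys)
  removeAll [] xs u h = xs , ⊆-refl , h , All.tabulate (λ _ ())
  removeAll (a ∷ L) {N} xs u h =
    let ys , τ , len , ps   = removeAll L xs u (≤-trans (≤-reflexive (+-suc (length L) N)) h)
        zs , σ , len′ , ps′ = removeOne a ys (AllPairs-resp-⊆ τ u) len
    in zs , ⊆-trans σ τ , len′ ,
       All.zipWith (λ { (≢a , ∉L) (here e) → ≢a e ; (≢a , ∉L) (there i) → ∉L i })
                   (ps′ , All-resp-⊆ σ ps)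

  -- If `xs` were longer than `L`, removing the entries of `L` would leave an entry of `xs` outside
  -- `L`.
  Unique-⊆⇒length-≤ : ∀ {xs L} → Unique xs → All (_∈ L) xs → length xs ≤ length L
  Unique-⊆⇒length-≤ {xs} {L} u all∈ with length xs ≤? length L
  ... | yes h = h
  ... | no ¬h with removeAll L xs u (≤-trans (≤-reflexive (+-comm (length L) 1)) (≰⇒> ¬h))
  ... | y ∷ _ , τ , _ , y∉L ∷ _ = contradiction (All.head (All-resp-⊆ τ all∈)) y∉L

  -- One Ramsey round per candidate `a`: either `h` avoids `a` on a large sublist, or the search
  -- continues on a sublist all of whose pairs have `a` in `h`. If every round fails, a single pair
  -- captures all candidates.
  avoidCandidate : (h : A → A → List A) → ∀ N as xs → candidateNumber (length as) N ≤ length xs →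
    (∃[ a ] (a ∈ as × Homogeneous (λ y z → a ∉ h y z) N xs)) ⊎
    Homogeneous (λ y z → All (_∈ h y z) as) 2 xs
  avoidCandidate h N [] (x ∷ y ∷ xs) _ =
    inj₂ (x ∷ y ∷ [] , refl ∷ refl ∷ minimum xs , refl , ([] ∷ []) ∷ [] ∷ [])
  avoidCandidate h N [] (x ∷ []) (s≤s ())
  avoidCandidate h N (a ∷ as) xs size
    with ramsey (λ y z → ¬? (a ∈? h y z)) N (candidateNumber (length as) N) xs size
  ... | inj₁ hom = inj₁ (a , here refl , hom)
  ... | inj₂ (ys , τ , len , ps)
    with avoidCandidate h N as ys (≤-reflexive (sym len))
  ... | inj₁ (b , b∈as , hom) = inj₁ (b , there b∈as , Homogeneous-⊆ τ hom)
  ... | inj₂ (zs , σ , len′ , qs) =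
    inj₂ (zs , ⊆-trans σ τ , len′ ,
          AllPairs.zipWith (λ { {y} {z} (p , q) → decidable-stable (a ∈? h y z) p ∷ q })
                           (AllPairs-resp-⊆ σ ps , qs))

  Free : (A → A → List A) → (A → List A) → List A → Set
  Free f g ys =
    AllPairs (λ y z → ∀ {w} → w ∈ ys → w ∈ f y z → w ≡ y ⊎ w ≡ z) ys ×
    All (λ y → ∀ {w} → w ∈ ys → w ∈ g y → w ≡ y) ys

  -- An element a that f y z and g z avoid on the pool is put in front; the demands of
  -- the pairs (a , z) are then carried by the unary mapping g.
  freeSet : ∀ k c e (f : A → A → List A) (g : A → List A) →
            (∀ y z → length (f y z) ≤ c) → (∀ y → length (g y) ≤ e) →
            ∀ xs → Unique xs → freeNumber k c e ≤ length xs →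
            ∃[ ys ] (ys ⊑ xs × length ys ≡ k × Free f g ys)
  freeSet zero    c e f g f≤ g≤ xs u size = [] , minimum xs , refl , [] , []
  freeSet (suc k) c e f g f≤ g≤ xs u size
    with avoidCandidate h N as pool pool-size
    where
    t N : ℕ
    t = suc (c + e)
    N = suc (e + freeNumber k c (e + c))
    as pool : List A
    as = take t xs
    pool = drop t xs
    h : A → A → List A
    h y z = f y z ++ g z
    as-length : length as ≡ t
    as-length = trans (length-take t xs) (m≤n⇒m⊓n≡m (≤-trans (m≤m+n t _) size))
    pool-size : candidateNumber (length as) N ≤ length pool
    pool-size rewrite as-length | length-drop t xs =
      ≤-trans (≤-reflexive (sym (m+n∸m≡n t _))) (∸-monoˡ-≤ t size)
  -- Here all `c + e + 1` distinct candidates would lie in `f y z ++ g z`, which has at most `c + e`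
  -- entries.
  ... | inj₂ (y ∷ z ∷ [] , _ , _ , (p ∷ []) ∷ _) =
    contradiction (Unique-⊆⇒length-≤ (AllPairs-resp-⊆ (take-⊆ (suc (c + e)) xs) u) p) (λ le →
      ≤⇒≯ le (≤-trans (s≤s (≤-trans (≤-reflexive (length-++ (f y z))) (+-mono-≤ (f≤ y z) (g≤ z))))
        (≤-reflexive (sym (trans (length-take (suc (c + e)) xs)
                                 (m≤n⇒m⊓n≡m (≤-trans (m≤m+n _ _) size)))))))
  -- Since `h y z` contains `g` of its second argument only, `y₀` serves as a common first argument
  -- giving `a ∉ g z` for all `z` in `zs`; it is then dropped, `g y₀` being uncontrolled.
  ... | inj₁ (a , a∈as , y₀ ∷ zs , τ , len , p ∷ ps) =
    let zs⊆pool = ⊆-trans (y₀ ∷ʳ ⊆-refl) τ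
        zs-uniq = AllPairs-resp-⊆ (⊆-trans zs⊆pool (drop-⊆ (suc (c + e)) xs)) u
        zs-size = ≤-trans (+-mono-≤ (g≤ a) ≤-refl) (≤-reflexive (sym (suc-injective len)))
        ys , ys⊆zs , ys-size , ys∉ga = removeAll (g a) zs zs-uniq zs-size
        us , us⊆ys , us-len , pairs , singles =
          freeSet k c (e + c) f (λ y → g y ++ f a y) f≤
            (λ y → ≤-trans (≤-reflexive (length-++ (g y))) (+-mono-≤ (g≤ y) (f≤ a y)))
            ys (AllPairs-resp-⊆ ys⊆zs zs-uniq) ys-size
        us⊆zs = ⊆-trans us⊆ys ys⊆zs
        a∉  = All-resp-⊆ us⊆zs p
        a∉′ = AllPairs-resp-⊆ us⊆zs ps
    in a ∷ us ,
       ⊆-trans (++⁺ (from∈ a∈as) (⊆-trans us⊆zs zs⊆pool)) (⊆-reflexive (take++drop≡id (suc (c + e)) xs)) ,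
       cong suc us-len ,
       -- Pairs `(a , z)` are free by the enlarged unary mapping. For the other pairs only `w = a`
       -- is new, and `a` is avoided there.
       (All.map (λ s → λ { (here refl) _ → inj₁ refl
                         ; (there w∈) i → inj₂ (s w∈ (∈-++⁺ʳ _ i)) }) singles
        ∷ AllPairs.zipWith (λ { (q , r) (here refl) i → contradiction (∈-++⁺ˡ i) q
                              ; (q , r) (there w∈) i → r w∈ i }) (a∉′ , pairs)) ,
       ((λ { (here refl) _ → refl
           ; (there w∈) i → contradiction i (All.lookup (All-resp-⊆ us⊆ys ys∉ga) w∈) })
        ∷ All.zipWith (λ { {y} (q , r) (here refl) i → contradiction (∈-++⁺ʳ (f y₀ y) i) q
                         ; (q , r) (there w∈) i → r w∈ (∈-++⁺ˡ i) }) (a∉ , singles))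

-- Enumeration of finite subsets and bounded search.

AllPairs-<⇒Unique : {xs : List (Fin n)} → AllPairs _<ᶠ_ xs → Unique xs
AllPairs-<⇒Unique = AllPairs.map (λ x<y x≡y → <-irrefl x≡y x<y)

Unique-lookup-injective : {xs : List A} → Unique xs → ∀ i j → lookup xs i ≡ lookup xs j → i ≡ j
Unique-lookup-injective ps i j eq with <-cmp i j
... | tri< i<j _ _ = contradiction eq (AllPairs-lookup ps i j i<j)
... | tri≈ _ i≡j _ = i≡j
... | tri> _ _ j<i = contradiction (sym eq) (AllPairs-lookup ps j i j<i)

elements : Subset n → List (Fin n)
elements []            = []
elements (inside  ∷ p) = zero ∷ map suc (elements p)
elements (outside ∷ p) = map suc (elements p)

length-elements : (p : Subset n) → length (elements p) ≡ ∣ p ∣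
length-elements []            = refl
length-elements (inside  ∷ p) = cong suc (trans (length-map suc (elements p)) (length-elements p))
length-elements (outside ∷ p) = trans (length-map suc (elements p)) (length-elements p)

-- Strong blocks index an unordered pair by its increasing order, so list order has to agree with
-- `_<ᶠ_`.
elements-sorted : (p : Subset n) → AllPairs _<ᶠ_ (elements p)
elements-sorted []            = []
elements-sorted (inside  ∷ p) =
  All.map⁺ (All.universal (λ _ → s≤s z≤n) (elements p)) ∷
  AllPairs.map⁺ (AllPairs.map s≤s (elements-sorted p))
elements-sorted (outside ∷ p) = AllPairs.map⁺ (AllPairs.map s≤s (elements-sorted p))

∈-elements⁺ : {p : Subset n} {x : Fin n} → x ∈ₛ p → x ∈ elements p
∈-elements⁺ {p = inside  ∷ p} here      = here refl
∈-elements⁺ {p = inside  ∷ p} (there i) = there (∈-map⁺ suc (∈-elements⁺ i))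
∈-elements⁺ {p = outside ∷ p} (there i) = ∈-map⁺ suc (∈-elements⁺ i)

∈-elements⁻ : (p : Subset n) {x : Fin n} → x ∈ elements p → x ∈ₛ p
∈-elements⁻ (inside ∷ p)  (here refl) = here
∈-elements⁻ (inside ∷ p)  (there i) with _ , j , refl ← ∈-map⁻ suc i = there (∈-elements⁻ p j)
∈-elements⁻ (outside ∷ p) i         with _ , j , refl ← ∈-map⁻ suc i = there (∈-elements⁻ p j)

comprehension : {P : Fin n → Set} → Decidable₁ P → Subset n
comprehension P? = Vec.tabulate (does ∘ P?)

∈-comprehension⁺ : {P : Fin n → Set} (P? : Decidable₁ P) {v : Fin n} → P v → v ∈ₛ comprehension P?
∈-comprehension⁺ P? {v} p =
  lookup⇒[]= v _ (trans (lookup∘tabulate (does ∘ P?) v) (dec-true (P? v) p))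

∈-comprehension⁻ : {P : Fin n → Set} (P? : Decidable₁ P) {v : Fin n} → v ∈ₛ comprehension P? → P v
∈-comprehension⁻ P? {v} i
  with P? v | trans (sym (lookup∘tabulate (does ∘ P?) v)) ([]=⇒lookup i)
... | yes p | _ = p

-- Exhaustive search over the finitely many lists of bounded length; it makes separability
-- decidable, as `ramsey` requires.
anyShortList? : {P : List (Fin n) → Set} → Decidable₁ P → ∀ L → Dec (∃[ xs ] (length xs ≤ L × P xs))
anyShortList? P? zero    = map′ (λ p → [] , z≤n , p) (λ { ([] , _ , p) → p }) (P? [])
anyShortList? P? (suc L) =
  map′ (λ { (inj₁ p) → [] , z≤n , p ; (inj₂ (x , xs , len , p)) → x ∷ xs , s≤s len , p })
       (λ { ([] , _ , p) → inj₁ p ; (x ∷ xs , s≤s len , p) → inj₂ (x , xs , len , p) })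
       (P? [] ⊎-dec any? (λ x → anyShortList? (P? ∘ (x ∷_)) L))

-- Short paths and their separators.

module _ (G : Graph) where

  open Graph G using (adj) renaming (n to ∣V∣)

  private
    V : Set
    V = Fin ∣V∣

  open DecMembership (_≟_ {∣V∣}) using (_∉?_)

  chain? : Decidable₁ (Chain G)
  chain? []          = yes tt
  chain? (x ∷ [])    = yes tt
  chain? (x ∷ y ∷ r) = (adj x y Bool.≟ true) ×-dec chain? (y ∷ r)

  isPath⇒chain : ∀ {U} p → IsPath G U p → Chain G p
  isPath⇒chain p (_ , _ , h) = go p (λ i j e → Equivalence.from (h i j) (inj₁ e))
    where
    go : ∀ p → (∀ i j → suc (toℕ i) ≡ toℕ j → Adj G (lookup p i) (lookup p j)) → Chain G p
    go []          h = tt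
    go (x ∷ [])    h = tt
    go (x ∷ y ∷ r) h = h zero (suc zero) refl , go (y ∷ r) (λ i j e → h (suc i) (suc j) (cong suc e))

  chain-ʳ++ : ∀ x xs acc → Chain G (x ∷ xs) → Chain G (x ∷ acc) → Chain G ((x ∷ xs) ʳ++ acc)
  chain-ʳ++ x []       acc _        c = c
  chain-ʳ++ x (y ∷ ys) acc (a , c′) c =
    chain-ʳ++ y ys (x ∷ acc) c′ (trans (Graph.sym G y x) a , c)

  head-ʳ++ : ∀ (x : V) xs acc → head ((x ∷ xs) ʳ++ acc) ≡ last (x ∷ xs)
  head-ʳ++ x []       acc = refl
  head-ʳ++ x (y ∷ ys) acc = head-ʳ++ y ys (x ∷ acc)

  last-ʳ++ : ∀ xs (y : V) acc → last (xs ʳ++ (y ∷ acc)) ≡ last (y ∷ acc)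
  last-ʳ++ []       y acc = refl
  last-ʳ++ (x ∷ xs) y acc = last-ʳ++ xs x (y ∷ acc)

  isSubPath-reverse : ∀ p → IsSubPath G p → IsSubPath G (reverse p)
  isSubPath-reverse []      sp      = sp
  isSubPath-reverse (x ∷ p) (u , c) =
    Permutation.Unique-resp-↭ (setoid V)
      (↭-sym (setoid V) (Permutation.↭-reverse (setoid V) (x ∷ p))) u ,
    chain-ʳ++ x p [] c tt

  fromTo-reverse : ∀ {x y} p → FromTo G x y p → FromTo G y x (reverse p)
  fromTo-reverse (z ∷ p) (hd , lst) = trans (head-ʳ++ z p []) lst , trans (last-ʳ++ p z []) hd

  module _ (d : ℕ) where

    -- At most `suc d` vertices means at most `d` edges. The paths need not be induced, so they can
    -- serve as links of a subdivision and also include the induced paths that stability forbids.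
    ShortPathAvoiding : V → V → List V → Set
    ShortPathAvoiding x y F =
      ∃[ p ] (length p ≤ suc d × (IsSubPath G p × FromTo G x y p) × All (_∉ F) p)

    shortPathAvoiding? : ∀ x y F → Dec (ShortPathAvoiding x y F)
    shortPathAvoiding? x y F = anyShortList? (λ p →
      ((DecUnique.unique? _≟_ p ×-dec chain? p) ×-dec
       (Maybe.≡-dec _≟_ (head p) (just x) ×-dec Maybe.≡-dec _≟_ (last p) (just y)))
      ×-dec All.all? (_∉? F) p) (suc d)

    shortPathAvoiding-sym : ∀ {x y F} → ShortPathAvoiding x y F → ShortPathAvoiding y x F
    shortPathAvoiding-sym (p , len , (sp , ft) , av) =
      reverse p , ≤-trans (≤-reflexive (length-reverse p)) len ,
      (isSubPath-reverse p sp , fromTo-reverse p ft) ,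
      All.tabulate (All.lookup av ∘ reverse⁻)

    Separates : V → V → List V → Set
    Separates x y F = x ∉ F × y ∉ F × ¬ ShortPathAvoiding x y F

    Separable : ℕ → V → V → Set
    Separable c x y = ∃[ F ] (length F ≤ c × Separates x y F)

    separable? : ∀ c → Decidable (Separable c)
    separable? c x y = anyShortList? (λ F →
      (x ∉? F) ×-dec (y ∉? F) ×-dec ¬? (shortPathAvoiding? x y F)) c

    -- The default `[]` keeps the bound `c` valid for every pair, as the free-set argument requires.
    separator : ℕ → V → V → List V
    separator c x y with separable? c x y
    ... | yes (F , _) = F
    ... | no _        = []

    length-separator : ∀ c x y → length (separator c x y) ≤ c
    length-separator c x y with separable? c x y
    ... | yes (_ , F≤c , _) = F≤c
    ... | no _              = z≤n

    separator-separates : ∀ c {x y} → Separable c x y → Separates x y (separator c x y)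
    separator-separates c {x} {y} sep with separable? c x y
    ... | yes (_ , _ , separates) = separates
    ... | no ¬sep                 = contradiction sep ¬sep

    -- Linking pairwise inseparable vertices into a subdivision.

    -- The links are chosen greedily: a new one has to avoid the m branch vertices and
    -- fewer than m * m earlier links, too few vertices to separate its ends.
    module _ (m : ℕ) (b : Fin m → V) (b-injective : ∀ i j → b i ≡ b j → i ≡ j)
             (inseparable : ∀ i j → i <ᶠ j → ¬ Separable (m + m * m * suc d) (b i) (b j)) where

      private
        E : Set
        E = Fin m × Fin m

      -- The length bound covers every `e`, including pairs with `i ≥ j`, so that the total size of
      -- `concatMap Q es` can be bounded.
      Linkage : List E → Set
      Linkage es = Σ (E → List V) λ Q →
        (∀ e → length (Q e) ≤ suc d)
        × (∀ i j → (i , j) ∈ es → i <ᶠ j →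
             IsSubPath G (Q (i , j)) × FromTo G (b i) (b j) (Q (i , j))
             × (∀ l → b l ∈ Q (i , j) → l ≡ i ⊎ l ≡ j))
        × (∀ i j i' j' → (i , j) ∈ es → (i' , j') ∈ es → i <ᶠ j → i' <ᶠ j' →
             ¬ (i ≡ i' × j ≡ j') →
             ∀ v → v ∈ Q (i , j) → v ∈ Q (i' , j') → ∃[ l ] (v ≡ b l))

      freshLink : ∀ i j → i <ᶠ j → ∀ F → length F ≤ m * m * suc d →
        ∃[ p ] (length p ≤ suc d × (IsSubPath G p × FromTo G (b i) (b j) p)
                × (∀ l → b l ∈ p → l ≡ i ⊎ l ≡ j)
                × (∀ v → v ∈ p → v ∈ F → ∃[ l ] (v ≡ b l)))
      freshLink i j i<j F F≤ =
        let p , len , sp , av = path in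
        p , len , sp ,
        (λ l i∈ → Sum.map (b-injective l i) (b-injective l j)
                    (ends (All.lookup av i∈) (∈-++⁺ˡ (∈-map⁺ b (∈-allFin l))))) ,
        (λ v i∈ v∈F → [ (λ e → i , e) , (λ e → j , e) ]′
                    (ends (All.lookup av i∈) (∈-++⁺ʳ (map b (allFin m)) v∈F)))
        where
        inner? : Decidable₁ (λ v → v ≢ b i × v ≢ b j)
        inner? v = ¬? (v ≟ b i) ×-dec ¬? (v ≟ b j)
        -- A separator may not contain the ends, so they are removed from the forbidden vertices.
        F⁺ : List V
        F⁺ = filter inner? (map b (allFin m) ++ F)
        F⁺≤ : length F⁺ ≤ m + m * m * suc d
        F⁺≤ = ≤-trans (length-filter inner? (map b (allFin m) ++ F))
               (≤-trans (≤-reflexive (length-++ (map b (allFin m))))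
                 (+-mono-≤ (≤-reflexive (trans (length-map b (allFin m)) (length-tabulate id))) F≤))
        path : ShortPathAvoiding (b i) (b j) F⁺
        -- Without such a path, `F⁺` would separate `b i` from `b j` within the size bound.
        path = decidable-stable (shortPathAvoiding? (b i) (b j) F⁺) λ none →
          inseparable i j i<j (F⁺ , F⁺≤ ,
            (λ i∈ → proj₁ (proj₂ (∈-filter⁻ inner? {xs = map b (allFin m) ++ F} i∈)) refl) ,
            (λ i∈ → proj₂ (proj₂ (∈-filter⁻ inner? {xs = map b (allFin m) ++ F} i∈)) refl) , none)
        ends : ∀ {v} → v ∉ F⁺ → v ∈ map b (allFin m) ++ F → v ≡ b i ⊎ v ≡ b j
        ends {v} v∉ v∈ with v ≟ b i | v ≟ b j
        ... | yes e | _     = inj₁ e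
        ... | no _  | yes e = inj₂ e
        ... | no e  | no e′ = contradiction (∈-filter⁺ inner? v∈ (e , e′)) v∉

      linkage : ∀ es → length es ≤ m * m → Linkage es
      linkage [] _ = (λ _ → []) , (λ _ → z≤n) , (λ _ _ ()) , (λ _ _ _ _ ())
      linkage ((i₀ , j₀) ∷ es) es≤ with linkage es (≤-trans (n≤1+n _) es≤) | i₀ <? j₀
      ... | Q , Q≤ , link , disj | no i₀≮j₀ =
        Q , Q≤ , (λ i j e∈ i<j → link i j (old e∈ i<j) i<j) ,
        (λ i j i' j' e∈ e'∈ i<j i'<j' → disj i j i' j' (old e∈ i<j) (old e'∈ i'<j') i<j i'<j')
        where
        old : ∀ {i j} → (i , j) ∈ (i₀ , j₀) ∷ es → i <ᶠ j → (i , j) ∈ es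
        old (here refl) i<j = contradiction i<j i₀≮j₀
        old (there e∈)  _   = e∈
      ... | Q , Q≤ , link , disj | yes i₀<j₀
        with freshLink i₀ j₀ i₀<j₀ (concatMap Q es)
               (≤-trans (length-concatMap-≤ Q Q≤ es) (*-monoˡ-≤ (suc d) (≤-trans (n≤1+n _) es≤)))
      ... | p , p≤ , (psub , pft) , pends , pmeets = Q′ , Q′≤ , link′ , disj′
        where
        _≟ₑ_ : DecidableEquality E
        _≟ₑ_ = Product.≡-dec _≟_ _≟_
        Q′ : E → List V
        Q′ e with e ≟ₑ (i₀ , j₀)
        ... | yes _ = p
        ... | no  _ = Q e
        Q′≤ : ∀ e → length (Q′ e) ≤ suc d
        Q′≤ e with e ≟ₑ (i₀ , j₀)
        ... | yes _ = p≤
        ... | no  _ = Q≤ e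
        old : ∀ {e} → e ≢ (i₀ , j₀) → e ∈ (i₀ , j₀) ∷ es → e ∈ es
        old ne (here eq)  = contradiction eq ne
        old ne (there e∈) = e∈
        link′ : ∀ i j → (i , j) ∈ (i₀ , j₀) ∷ es → i <ᶠ j →
             IsSubPath G (Q′ (i , j)) × FromTo G (b i) (b j) (Q′ (i , j))
             × (∀ l → b l ∈ Q′ (i , j) → l ≡ i ⊎ l ≡ j)
        link′ i j e∈ i<j with (i , j) ≟ₑ (i₀ , j₀)
        ... | yes refl = psub , pft , pends
        ... | no ne    = link i j (old ne e∈) i<j
        disj′ : ∀ i j i' j' → (i , j) ∈ (i₀ , j₀) ∷ es → (i' , j') ∈ (i₀ , j₀) ∷ es →
             i <ᶠ j → i' <ᶠ j' → ¬ (i ≡ i' × j ≡ j') →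
             ∀ v → v ∈ Q′ (i , j) → v ∈ Q′ (i' , j') → ∃[ l ] (v ≡ b l)
        disj′ i j i' j' e∈ e'∈ i<j i'<j' ne v v∈ v∈'
          with (i , j) ≟ₑ (i₀ , j₀) | (i' , j') ≟ₑ (i₀ , j₀)
        ... | yes refl | yes refl = contradiction (refl , refl) ne
        -- The older link is part of `concatMap Q es`, which the new one meets only in branch
        -- vertices.
        ... | yes refl | no ne'   = pmeets v v∈ (∈-concatMap⁺ Q (lose (old ne' e'∈) v∈'))
        ... | no ne'   | yes refl = pmeets v v∈' (∈-concatMap⁺ Q (lose (old ne' e∈) v∈))
        ... | no ne₁   | no ne₂   = disj i j i' j' (old ne₁ e∈) (old ne₂ e'∈) i<j i'<j' ne v v∈ v∈'

      inseparable⇒subdivision : HasSubdivision G d m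
      inseparable⇒subdivision =
        let Q , Q≤ , link , disj = linkage pairs pairs≤
        in b , (λ i j → Q (i , j)) , b-injective ,
           (λ i j i<j → let sp , ft , ends = link i j (all∈ i j) i<j in
              sp , ft , ≤-trans (∸-monoˡ-≤ 1 (Q≤ (i , j))) (n≤1+n d) , ends) ,
           (λ i j i' j' → disj i j i' j' (all∈ i j) (all∈ i' j'))
        where
        pairs : List E
        pairs = concatMap (λ i → map (i ,_) (allFin m)) (allFin m)
        all∈ : ∀ i j → (i , j) ∈ pairs
        all∈ i j = ∈-concatMap⁺ _ (lose (∈-allFin i) (∈-map⁺ (i ,_) (∈-allFin j)))
        pairs≤ : length pairs ≤ m * m
        pairs≤ = ≤-trans
          (length-concatMap-≤ _
            (λ i → ≤-reflexive (trans (length-map (i ,_) (allFin m)) (length-tabulate id))) (allFin m))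
          (≤-reflexive (cong (_* m) (length-tabulate {n = m} id)))

-- Owners and demands in a strong block.

module _ (G : Graph) (d c K : ℕ) (B : Subset (Graph.n G)) (block : StrongBlock G ⊤ K B) where

  open Graph G using () renaming (n to ∣V∣)

  private
    V : Set
    V = Fin ∣V∣

    cnt : V → V → ℕ
    cnt = proj₁ (proj₂ (proj₂ block))

    paths : ∀ x y → Fin (cnt x y) → List V
    paths = proj₁ (proj₂ (proj₂ (proj₂ block)))

    collection = proj₁ (proj₂ (proj₂ (proj₂ (proj₂ block))))
    cross      = proj₂ (proj₂ (proj₂ (proj₂ (proj₂ block))))

    X : V → V → List V
    X = separator G d c

    X≤ : ∀ x y → length (X x y) ≤ c
    X≤ = length-separator G d c

  open DecMembership (_≟_ {∣V∣}) using (_∈?_)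

  owner? : ∀ v → Dec (∃[ z ] ∃[ w ] ((z ∈ₛ B × w ∈ₛ B × z <ᶠ w) × ∃[ i ] (v ∈ paths z w i)))
  owner? v = any? λ z → any? λ w →
    ((z ∈ₛ? B) ×-dec (w ∈ₛ? B) ×-dec (z <? w)) ×-dec any? (λ i → v ∈? paths z w i)

  -- By `cross`, if paths of two different pairs contain `v`, then `v` is an end of both pairs. So
  -- the pair found is the only one whenever `v` is not one of its ends.
  owners : V → List V
  owners v with owner? v
  ... | yes (z , w , _) = z ∷ w ∷ []
  ... | no _            = []

  -- Freeness for these lists keeps separator vertices out of the chosen set, and allows both owners
  -- of such a vertex into it only if they are `x` and `y`. Each vertex contributes itself and at
  -- most two owners, whence the factor 3.
  demands : V → V → List V
  demands x y = concatMap (λ v → v ∷ owners v) (X x y)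

  demands≤ : ∀ x y → length (demands x y) ≤ c * 3
  demands≤ x y = ≤-trans (length-concatMap-≤ _ owners≤ (X x y)) (*-monoˡ-≤ 3 (X≤ x y))
    where
    owners≤ : ∀ v → suc (length (owners v)) ≤ 3
    owners≤ v with owner? v
    ... | yes _ = ≤-refl
    ... | no _  = s≤s z≤n

  -- Deleting the separators of a free set.

  module _ {k : ℕ} (c+k≤K : c + k ≤ K)
    (ys : List V) (ys⊆B : ∀ {x} → x ∈ ys → x ∈ₛ B) (k≤ys : k ≤ length ys)
    (sorted : AllPairs _<ᶠ_ ys)
    (separated : AllPairs (λ x y → Separates G d x y (X x y)) ys)
    (free : AllPairs (λ x y → ∀ {w} → w ∈ ys → w ∈ demands x y → w ≡ x ⊎ w ≡ y) ys) where

    pairs : ∀ {x y} → x ∈ ys → y ∈ ys → x <ᶠ y →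
      Separates G d x y (X x y) × (∀ {w} → w ∈ ys → w ∈ demands x y → w ≡ x ⊎ w ≡ y)
    pairs x∈ y∈ x<y
      with ∈-AllPairs₂ (AllPairs.zip (sorted , AllPairs.zip (separated , free))) x∈ y∈
    ... | inj₁ refl             = contradiction x<y (<-irrefl refl)
    ... | inj₂ (inj₁ (_ , p))   = p
    ... | inj₂ (inj₂ (y<x , _)) = contradiction y<x (<-asym x<y)

    Deleted : V → Set
    Deleted v = ∃[ x ] ∃[ y ] ((x ∈ ys × y ∈ ys × x <ᶠ y) × v ∈ X x y)

    deleted? : Decidable₁ Deleted
    deleted? v = any? λ x → any? λ y →
      ((x ∈? ys) ×-dec (y ∈? ys) ×-dec (x <? y)) ×-dec (v ∈? X x y)

    S : Subset ∣V∣
    S = comprehension (_∈? ys)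

    D : Subset ∣V∣
    D = comprehension deleted?

    ∈S⁻ : ∀ {v} → v ∈ₛ S → v ∈ ys
    ∈S⁻ = ∈-comprehension⁻ (_∈? ys)

    ¬deleted⇒∈∁D : ∀ {v} → ¬ Deleted v → v ∈ₛ ∁ D
    ¬deleted⇒∈∁D ¬del = x∉p⇒x∈∁p (¬del ∘ ∈-comprehension⁻ deleted?)

    -- A vertex of `X x y` is among the demands of `x` and `y`, so inside `ys` it would be `x` or
    -- `y`, but a separator contains neither end.
    deleted∉ys : ∀ {v} → Deleted v → v ∉ ys
    deleted∉ys (x , y , (x∈ , y∈ , x<y) , v∈X) v∈ys
      with pairs x∈ y∈ x<y
    ... | (x∉X , y∉X , _) , fr with fr v∈ys (∈-concatMap⁺ _ (lose v∈X (here refl)))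
    ... | inj₁ refl = x∉X v∈X
    ... | inj₂ refl = y∉X v∈X

    -- This confines the damage to the paths of a pair to its own separator. If `v` comes from
    -- `X x y`, its owners `z` and `w` are demanded by `x` and `y`, and freeness identifies the two
    -- pairs.
    deleted∈X : ∀ {v z w} i → z ∈ ys → w ∈ ys → z <ᶠ w → v ∈ paths z w i → Deleted v → v ∈ X z w
    deleted∈X {v} {z} {w} i z∈ w∈ z<w v∈p del@(x , y , (x∈ , y∈ , x<y) , v∈X) =
      conclude (demand (here refl)) (demand (there (here refl)))
      where
      owners≡ : owners v ≡ z ∷ w ∷ []
      owners≡ with owner? v
      ... | no none = contradiction (z , w , (ys⊆B z∈ , ys⊆B w∈ , z<w) , i , v∈p) none
      ... | yes (z' , w' , (z'∈ , w'∈ , z'<w') , i' , v∈p') with z' ≟ z | w' ≟ w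
      ... | yes refl | yes refl = refl
      -- A different owner pair would make `v` an end of `(z , w)`, hence an entry of `ys`, which a
      -- deleted vertex is not.
      ... | no ne | _ =
        contradiction (proj₂ (cross z' w' z w z'∈ w'∈ (ys⊆B z∈) (ys⊆B w∈) z'<w' z<w (ne ∘ proj₁) i' i v v∈p' v∈p))
          [ (λ { refl → deleted∉ys del z∈ }) , (λ { refl → deleted∉ys del w∈ }) ]′
      ... | yes _ | no ne =
        contradiction (proj₂ (cross z' w' z w z'∈ w'∈ (ys⊆B z∈) (ys⊆B w∈) z'<w' z<w (ne ∘ proj₂) i' i v v∈p' v∈p))
          [ (λ { refl → deleted∉ys del z∈ }) , (λ { refl → deleted∉ys del w∈ }) ]′
      demand : ∀ {u} → u ∈ z ∷ w ∷ [] → u ∈ demands x y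
      demand u∈ = ∈-concatMap⁺ _ (lose v∈X (there (subst (_ ∈_) (sym owners≡) u∈)))
      conclude : z ∈ demands x y → w ∈ demands x y → v ∈ X z w
      conclude z∈d w∈d with proj₂ (pairs x∈ y∈ x<y) z∈ z∈d | proj₂ (pairs x∈ y∈ x<y) w∈ w∈d
      ... | inj₁ refl | inj₁ refl = contradiction z<w (<-irrefl refl)
      ... | inj₁ refl | inj₂ refl = v∈X
      ... | inj₂ refl | inj₁ refl = contradiction z<w (<-asym x<y)
      ... | inj₂ refl | inj₂ refl = contradiction z<w (<-irrefl refl)

    Survives : ∀ x y → Fin (cnt x y) → Set
    Survives x y i = All (¬_ ∘ Deleted) (paths x y i)

    survives? : ∀ x y → Decidable₁ (Survives x y)
    survives? x y i = All.all? (¬? ∘ deleted?) (paths x y i)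

    survivors : ∀ x y → List (Fin (cnt x y))
    survivors x y = filter (survives? x y) (allFin (cnt x y))

    module _ {z w : V} (z∈ : z ∈ ys) (w∈ : w ∈ ys) (z<w : z <ᶠ w) where

      hit : V → List (Fin (cnt z w))
      hit v with any? (λ i → v ∈? paths z w i)
      ... | yes (i , _) = i ∷ []
      ... | no _        = []

      hit≤ : ∀ v → length (hit v) ≤ 1
      hit≤ v with any? (λ i → v ∈? paths z w i)
      ... | yes _ = ≤-refl
      ... | no _  = z≤n

      -- Two paths of one pair share only `z` and `w`, which are not deleted, so the path found by
      -- the search is the only one through `v`.
      ∈-hit : ∀ {v} j → v ∈ paths z w j → Deleted v → j ∈ hit v
      ∈-hit {v} j v∈p del with any? (λ i → v ∈? paths z w i)
      ... | no none = contradiction (j , v∈p) none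
      ... | yes (i , v∈p') with i ≟ j
      ... | yes refl = here refl
      ... | no i≢j with proj₂ (proj₂ (proj₂ (collection z w (ys⊆B z∈) (ys⊆B w∈) z<w))) i j i≢j v v∈p' v∈p
      ... | inj₁ refl = contradiction z∈ (deleted∉ys del)
      ... | inj₂ refl = contradiction w∈ (deleted∉ys del)

      -- Each of the at most `c` vertices of `X z w` destroys at most one path, and the block
      -- supplies at least `c + k`.
      survivors≥k : k ≤ length (survivors z w)
      survivors≥k =
        let js , τ , k≤js , js∉ = removeAll _≟_ hits (allFin (cnt z w)) (Unique.allFin⁺ _) size
            js-survive = All.map (λ {j} j∉ → All.tabulate λ v∈p del →
              j∉ (∈-concatMap⁺ hit (lose (deleted∈X j z∈ w∈ z<w v∈p del) (∈-hit j v∈p del)))) js∉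
        in ≤-trans k≤js (≤-trans (≤-reflexive (cong length (sym (filter-all (survives? z w) js-survive))))
             (length-mono-≤ (⊆-filter⁺ (survives? z w) (survives? z w) (λ { refl s → s }) τ)))
        where
        hits : List (Fin (cnt z w))
        hits = concatMap hit (X z w)
        hits≤ : length hits ≤ c
        hits≤ = ≤-trans (length-concatMap-≤ hit hit≤ (X z w))
                  (≤-trans (≤-reflexive (*-identityʳ _)) (X≤ z w))
        size : length hits + k ≤ length (allFin (cnt z w))
        size = ≤-trans (+-monoˡ-≤ k hits≤)
                 (≤-trans (≤-trans c+k≤K (proj₁ (collection z w (ys⊆B z∈) (ys⊆B w∈) z<w)))
                   (≤-reflexive (sym (length-tabulate id))))

    S⊆B∩∁D : S ⊆ B ∩ ∁ D
    S⊆B∩∁D v∈S = x∈p∩q⁺ (ys⊆B (∈S⁻ v∈S) , ¬deleted⇒∈∁D (λ del → deleted∉ys del (∈S⁻ v∈S)))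

    strongBlock : StrongBlock G (∁ D) k S
    strongBlock =
      (λ v∈S → ¬deleted⇒∈∁D (λ del → deleted∉ys del (∈S⁻ v∈S))) ,
      ≤-trans k≤ys (≤-trans
        (Unique-⊆⇒length-≤ _≟_ (AllPairs-<⇒Unique sorted)
          (All.tabulate (∈-elements⁺ ∘ ∈-comprehension⁺ (_∈? ys))))
        (≤-reflexive (length-elements S))) ,
      (λ x y → length (survivors x y)) ,
      (λ x y i → paths x y (lookup (survivors x y) i)) ,
      (λ x y x∈S y∈S x<y →
        let x∈ = ∈S⁻ x∈S
            y∈ = ∈S⁻ y∈S
            _ , path , distinct , disjoint = collection x y (ys⊆B x∈) (ys⊆B y∈) x<y
        in survivors≥k x∈ y∈ x<y ,
           -- The adjacency condition does not depend on the vertex set, so a surviving path stays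
           -- induced after the deletion.
           (λ i → let (_ , uniq , induced) , ft = path (lookup (survivors x y) i) in
              (All.map ¬deleted⇒∈∁D (proj₂ (∈-filter⁻ (survives? x y) {xs = allFin _} (∈-lookup i))) ,
               uniq , induced) , ft) ,
           (λ i j i≢j → distinct _ _ (i≢j ∘ survivors-injective x y i j)) ,
           (λ i j i≢j → disjoint _ _ (i≢j ∘ survivors-injective x y i j))) ,
      (λ x y x' y' x∈ y∈ x'∈ y'∈ x<y x'<y' ne i i' →
        cross x y x' y' (ys⊆B (∈S⁻ x∈)) (ys⊆B (∈S⁻ y∈)) (ys⊆B (∈S⁻ x'∈)) (ys⊆B (∈S⁻ y'∈)) x<y x'<y' ne _ _)
      where
      survivors-injective : ∀ x y i j → lookup (survivors x y) i ≡ lookup (survivors x y) j → i ≡ j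
      survivors-injective x y =
        Unique-lookup-injective (Unique.filter⁺ (survives? x y) (Unique.allFin⁺ (cnt x y)))

    -- The ends `u`, `v` are kept apart from `x`, `y` so that paths running against the order are
    -- covered too; `stable` reverses those.
    avoidsX : ∀ {x y u v} → x ∈ ys → y ∈ ys → x <ᶠ y →
      ∃[ p ] (IsPath G (∁ D) p × FromTo G u v p × pathLength G p ≤ d) →
      ShortPathAvoiding G d u v (X x y)
    avoidsX {x} {y} x∈ y∈ x<y (p , isPath@(p⊆∁D , uniq , _) , ft , len) =
      p , ≤-trans (m≤n+m∸n (length p) 1) (s≤s len) , ((uniq , isPath⇒chain G p isPath) , ft) ,
      All.map (λ v∈∁D v∈X →
        x∈∁p⇒x∉p v∈∁D (∈-comprehension⁺ deleted? (x , y , (x∈ , y∈ , x<y) , v∈X))) p⊆∁D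

    stable : Stable G (∁ D) d S
    stable u v u∈S v∈S u≢v path with ∈S⁻ u∈S | ∈S⁻ v∈S | <-cmp u v
    ... | _  | _  | tri≈ _ u≡v _ = u≢v u≡v
    ... | u∈ | v∈ | tri< u<v _ _ =
      let (_ , _ , none) , _ = pairs u∈ v∈ u<v in none (avoidsX u∈ v∈ u<v path)
    ... | u∈ | v∈ | tri> _ _ v<u =
      let (_ , _ , none) , _ = pairs v∈ u∈ v<u in
      none (shortPathAvoiding-sym G d (avoidsX v∈ u∈ v<u path))

-- Choice of the constants and conclusion.

theorem7p2 : ∀ (d k m : ℕ) → 1 ≤ d → 1 ≤ k → 2 ≤ m →
    ∃[ k₀ ] (1 ≤ k₀ ×
    (∀ (G : Graph) (B₀ : Subset (Graph.n G)) →
    StrongBlock G ⊤ k₀ B₀ →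
    ¬ HasSubdivision G d m →
    ∃[ A ] ∃[ S ] (S ⊆ B₀ ∩ ∁ A ×
    StrongBlock G (∁ A) k S × Stable G (∁ A) d S)))
-- The summand `c + k` provides enough paths per pair, `r` enough vertices for Ramsey, and `suc`
-- makes the bound positive.
theorem7p2 d k m _ _ _ = suc (c + k + r) , s≤s z≤n , main
  where
  c N r : ℕ
  -- The `m` branch vertices and at most `m * m` links of at most `d + 1` vertices each.
  c = m + m * m * suc d
  N = freeNumber k (c * 3) 0
  r = ramseyNumber N m

  main : ∀ G B → StrongBlock G ⊤ (suc (c + k + r)) B → ¬ HasSubdivision G d m →
         ∃[ A ] ∃[ S ] (S ⊆ B ∩ ∁ A × StrongBlock G (∁ A) k S × Stable G (∁ A) d S)
  main G B block noSub
    with ramsey (separable? G d c) N m (elements B)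
           (≤-trans (m≤n⇒m≤1+n (m≤n+m r (c + k)))
             (≤-trans (proj₁ (proj₂ block)) (≤-reflexive (sym (length-elements B)))))
  -- Matching `refl` turns `m` into `length ys`, so `lookup ys` gives the branch vertices.
  ... | inj₂ (ys , ys⊑B , refl , inseparable) =
    contradiction
      (inseparable⇒subdivision G d (length ys) (lookup ys)
        (Unique-lookup-injective (AllPairs-resp-⊆ ys⊑B (AllPairs-<⇒Unique (elements-sorted B))))
        (AllPairs-lookup inseparable))
      noSub
  ... | inj₁ (zs , zs⊑B , len , separable)
    -- The unary mapping starts empty, whence the 0 in `N`.
    with freeSet _≟_ k (c * 3) 0 (demands G d c _ B block) (λ _ → [])
           (demands≤ G d c _ B block) (λ _ → z≤n) zs
           (AllPairs-resp-⊆ zs⊑B (AllPairs-<⇒Unique (elements-sorted B)))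
           (≤-reflexive (sym len))
  ... | ys , ys⊑zs , ys-len , free , _ =
    _ , _ , S⊆B∩∁D G d c _ B block c+k≤ ys ys∈ (≤-reflexive (sym ys-len)) sorted separated free ,
    strongBlock G d c _ B block c+k≤ ys ys∈ (≤-reflexive (sym ys-len)) sorted separated free ,
    stable G d c _ B block c+k≤ ys ys∈ (≤-reflexive (sym ys-len)) sorted separated free
    where
    c+k≤ : c + k ≤ suc (c + k + r)
    c+k≤ = m≤n⇒m≤1+n (m≤m+n (c + k) r)
    ys⊑B = ⊆-trans ys⊑zs zs⊑B
    ys∈ : ∀ {x} → x ∈ ys → x ∈ₛ B
    ys∈ = ∈-elements⁻ B ∘ Any-resp-⊆ ys⊑B
    sorted = AllPairs-resp-⊆ ys⊑B (elements-sorted B)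
    separated = AllPairs.map (separator-separates G d c) (AllPairs-resp-⊆ ys⊑zs separable)
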